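{- Let $R$ be any TRS over $sign(R)$, and let $\Sigma=\{f,\sharp\}\cup sign(R)$, where $f\in\Sigma_2-sign(R)$ and $\sharp\in\Sigma_0-sign(R)$. Then $R$ is a P$\Sigma$RF-TRS if and only if $R$ is a PRF-TRS.
   Context: A ranked alphabet $\Sigma$ is a finite set of symbols with ranks, $\Sigma_m$ the symbols of rank $m$; $X$ a countable set of variables, $T_\Sigma(X)$ the terms, $T_\Sigma$ the ground terms. A TRS $R$ is a finite set of rules $l\to r$ of terms with every variable of $r$ occurring in $l$; $sign(R)$ is the ranked alphabet of symbols in its rules. $R^*_\Gamma(L)=\{p\mid q\Rightarrow^*_R p,\ q\in L\}$ for $L\subseteq T_\Gamma$ (with $R$ regarded as a TRS over $\Gamma$). A tree language is recognizable if recognized by a bottom-up tree automaton. $R$ is a P$\Gamma$RF-TRS if $R^*_\Gamma(L)$ is recognizable for every finite $L\subseteq T_\Gamma$. $R$ is a PRF-TRS if it is a P$\Gamma$RF-TRS for every ranked alphabet $\Gamma\supseteq sign(R)$. -}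

module Defs where

open import Data.Nat using (ℕ)
open import Data.Fin using (Fin)
open import Data.Bool using (Bool; true)
open import Data.List using (List; []; _∷_; _++_; concatMap)
open import Data.List.Membership.Propositional using (_∈_)
open import Data.List.Relation.Unary.All using (All)
open import Data.Vec using (Vec; []; _∷_; lookup; _[_]≔_)
open import Data.Product using (Σ; ∃; _×_; _,_)
open import Relation.Binary.PropositionalEquality using (_≡_)
open import Relation.Binary.Construct.Closure.ReflexiveTransitive using (Star)

-- Symbols. We fix a countably infinite universe of ranked symbols:
-- a symbol is a name together with its rank. A ranked alphabet is a
-- finite set (list) of such symbols; Σ_m = symbols of the alphabet of rank m.

record Sym : Set where
  constructor mkSym
  field
    name : ℕ
    rank : ℕ
open Sym public

RankedAlphabet : Set
RankedAlphabet = List Sym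

data Term : Set where
  var  : ℕ → Term
  node : (s : Sym) → Vec Term (rank s) → Term

mutual
  syms : Term → List Sym
  syms (var x)     = []
  syms (node s ts) = s ∷ symsV ts

  symsV : ∀ {n} → Vec Term n → List Sym
  symsV []       = []
  symsV (t ∷ ts) = syms t ++ symsV ts

mutual
  vars : Term → List ℕ
  vars (var x)     = x ∷ []
  vars (node s ts) = varsV ts

  varsV : ∀ {n} → Vec Term n → List ℕ
  varsV []       = []
  varsV (t ∷ ts) = vars t ++ varsV ts

OverΓ : RankedAlphabet → Term → Set
OverΓ Γ t = ∀ s → s ∈ syms t → s ∈ Γ

Ground : RankedAlphabet → Term → Set
Ground Γ t = OverΓ Γ t × vars t ≡ []

record Rule : Set where
  constructor _⟶_∣_
  field
    lhs : Term
    rhs : Term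
    varCond : ∀ x → x ∈ vars rhs → x ∈ vars lhs
open Rule public

TRS : Set
TRS = List Rule

sign : TRS → RankedAlphabet
sign R = concatMap (λ ρ → syms (lhs ρ) ++ syms (rhs ρ)) R

mutual
  subst : (ℕ → Term) → Term → Term
  subst σ (var x)     = σ x
  subst σ (node s ts) = node s (substV σ ts)

  substV : ∀ {n} → (ℕ → Term) → Vec Term n → Vec Term n
  substV σ []       = []
  substV σ (t ∷ ts) = subst σ t ∷ substV σ ts

data _⊢_⇒_ (R : TRS) : Term → Term → Set where
  root : ∀ ρ (σ : ℕ → Term) → ρ ∈ R → R ⊢ subst σ (lhs ρ) ⇒ subst σ (rhs ρ)
  cong : ∀ s (ts : Vec Term (rank s)) (i : Fin (rank s)) u →
         R ⊢ lookup ts i ⇒ u → R ⊢ node s ts ⇒ node s (ts [ i ]≔ u)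

_⊢_⇒*_ : TRS → Term → Term → Set
R ⊢ t ⇒* u = Star (R ⊢_⇒_) t u

Descendants : TRS → RankedAlphabet → (Term → Set) → Term → Set
Descendants R Γ L p = Ground Γ p × ∃ λ q → L q × R ⊢ q ⇒* p

record TreeAutomaton : Set where
  field
    nStates : ℕ
    δ       : (s : Sym) → Vec (Fin nStates) (rank s) → Fin nStates → Bool
    final   : Fin nStates → Bool
open TreeAutomaton public

mutual
  data Run (A : TreeAutomaton) : Term → Fin (nStates A) → Set where
    run : ∀ s (ts : Vec Term (rank s)) qs q →
          RunV A ts qs → δ A s qs q ≡ true → Run A (node s ts) q

  data RunV (A : TreeAutomaton) : ∀ {n} → Vec Term n → Vec (Fin (nStates A)) n → Set where
    []  : RunV A [] []
    _∷_ : ∀ {n t q} {ts : Vec Term n} {qs} → Run A t q → RunV A ts qs → RunV A (t ∷ ts) (q ∷ qs)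

Lang : RankedAlphabet → TreeAutomaton → Term → Set
Lang Γ A t = Ground Γ t × ∃ λ q → Run A t q × final A q ≡ true

Recognizable : RankedAlphabet → (Term → Set) → Set
Recognizable Γ L = ∃ λ A → ∀ t → (L t → Lang Γ A t) × (Lang Γ A t → L t)

FinLang : List Term → Term → Set
FinLang ts t = t ∈ ts

PΓRF : TRS → RankedAlphabet → Set
PΓRF R Γ = (L : List Term) → All (Ground Γ) L →
           Recognizable Γ (Descendants R Γ (FinLang L))

_⊇_ : RankedAlphabet → RankedAlphabet → Set
Γ ⊇ Δ = ∀ s → s ∈ Δ → s ∈ Γ

PRF : TRS → Set
PRF R = (Γ : RankedAlphabet) → Γ ⊇ sign R → PΓRF R Γ

{-# OPTIONS --safe #-}
-- Code a symbol g outside sign R by f and ♯: g(t₁,…,tₖ) becomes f(N,[t₁,…,tₖ]), where lists are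
-- built from f as cons and ♯ as nil, and N is a list of ♯'s whose length is the name of g (the
-- rank is the length of the second list). Rewriting of t is mirrored by rewriting of its code,
-- and recognizable languages are closed under the inverse of the coding, so it remains to see
-- that encode t ⇒* encode u implies t ⇒* u. A rule whose left-hand side is a variable may also
-- rewrite inside a code, putting contexts over sign R between its f's. The decoding pulls all
-- such contexts out to the root of the coded symbol; as it then commutes with substitution
-- into terms over sign R, it maps every rewrite step to a sequence of rewrite steps.
module Submission where

open import Defs
open import Data.Nat using (ℕ)
import Data.Nat.Properties as ℕ
open import Data.Bool using (true; false; if_then_else_)
import Data.Bool.Properties as Bool
open import Data.Fin using (Fin; zero; suc)
open import Data.Fin.Properties using (any?)
open import Data.List using (List; []; _∷_; _++_; map)
open import Data.List.Membership.Propositional using (_∈_; _∉_; lose)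
open import Data.List.Membership.Propositional.Properties
  using (∈-++⁺ˡ; ∈-++⁺ʳ; ∈-++⁻; ∈-concatMap⁺; ∈-map⁺; ∈-map⁻)
import Data.List.Membership.DecPropositional as DecMembership
open import Data.List.Properties using (++-conicalˡ; ++-conicalʳ)
open import Data.List.Relation.Unary.All using (All; tabulate; lookup)
open import Data.List.Relation.Unary.Any using (here; there)
open import Data.Product using (∃; _×_; _,_; proj₁; proj₂)
open import Data.Sum using (inj₁; inj₂)
open import Data.Vec using (Vec; []; _∷_; replicate; _[_]≔_)
import Data.Vec as Vec
open import Data.Vec.Relation.Binary.Pointwise.Inductive as Pointwise using (Pointwise; []; _∷_)
open import Function using (_∘_)
open import Function.Bundles using (_⇔_; mk⇔)
open import Relation.Binary using (DecidableEquality)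
open import Relation.Binary.Construct.Closure.ReflexiveTransitive
  using (ε; _◅◅_; gmap; kleisliStar; return)
open import Relation.Binary.PropositionalEquality as ≡ using (_≡_; refl; cong₂)
open import Relation.Nullary using (Dec; yes; no; does)
open import Relation.Nullary.Decidable using (map′; _×-dec_; dec-true; dec-false)

_≟ˢ_ : DecidableEquality Sym
mkSym m k ≟ˢ mkSym n l =
  map′ (λ (p , q) → cong₂ mkSym p q) (λ p → ≡.cong name p , ≡.cong rank p)
    ((m ℕ.≟ n) ×-dec (k ℕ.≟ l))

open DecMembership _≟ˢ_ using (_∈?_)

-- Rewriting in several arguments

module _ {R : TRS} where

  -- Generalizing from `node s` to an arbitrary `h` lets the induction store each rewritten argument
  -- in `h` and go on to the remaining ones.
  steps-cong : ∀ {n} (h : Vec Term n → Term) →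
    (∀ ts i u → R ⊢ Vec.lookup ts i ⇒ u → R ⊢ h ts ⇒ h (ts [ i ]≔ u)) →
    ∀ {ts us} → Pointwise (R ⊢_⇒*_) ts us → R ⊢ h ts ⇒* h us
  steps-cong h step [] = ε
  steps-cong h step {t ∷ ts} {u ∷ us} (p ∷ ps) =
    gmap (λ v → h (v ∷ ts)) (λ {v} → step (v ∷ ts) zero _) p ◅◅
    steps-cong (h ∘ (u ∷_)) (λ vs i → step (u ∷ vs) (suc i)) ps

  node-cong : ∀ s {ts us} → Pointwise (R ⊢_⇒*_) ts us → R ⊢ node s ts ⇒* node s us
  node-cong s = steps-cong (node s) (cong s)

  steps-refl : ∀ {n} {ts : Vec Term n} → Pointwise (R ⊢_⇒*_) ts ts
  steps-refl = Pointwise.refl ε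

lhs-over-sign : ∀ {R ρ} → ρ ∈ R → OverΓ (sign R) (lhs ρ)
lhs-over-sign ρ∈R s s∈ = ∈-concatMap⁺ _ (lose ρ∈R (∈-++⁺ˡ s∈))

rhs-over-sign : ∀ {R ρ} → ρ ∈ R → OverΓ (sign R) (rhs ρ)
rhs-over-sign {ρ = ρ} ρ∈R s s∈ = ∈-concatMap⁺ _ (lose ρ∈R (∈-++⁺ʳ (syms (lhs ρ)) s∈))

-- Decidability of runs

module _ (A : TreeAutomaton) where

  mutual
    run? : ∀ t q → Dec (Run A t q)
    run? (var x)     q = no λ ()
    run? (node s ts) q =
      map′ (λ (qs , rs , e) → run s ts qs q rs e) (λ { (run _ _ qs _ rs e) → qs , rs , e })
        (anyRunV? ts (λ qs → δ A s qs q Bool.≟ true))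

    -- The predicate `P` absorbs the state chosen for the first argument, so only searches over
    -- single states occur.
    anyRunV? : ∀ {n} (ts : Vec Term n) {P : Vec (Fin (nStates A)) n → Set} →
      (∀ qs → Dec (P qs)) → Dec (∃ λ qs → RunV A ts qs × P qs)
    anyRunV? []       P? = map′ (λ p → [] , [] , p) (λ { ([] , [] , p) → p }) (P? [])
    anyRunV? (t ∷ ts) P? =
      map′ (λ (q , r , qs , rs , p) → q ∷ qs , r ∷ rs , p)
        (λ { (q ∷ qs , r ∷ rs , p) → q , r , qs , rs , p })
        (any? λ q → run? t q ×-dec anyRunV? ts (λ qs → P? (q ∷ qs)))

module Coding (R : TRS) (f₀ ♯₀ : ℕ) (f∉ : mkSym f₀ 2 ∉ sign R) (♯∉ : mkSym ♯₀ 0 ∉ sign R) where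

  Δ : RankedAlphabet
  Δ = sign R

  f ♯ : Sym
  f = mkSym f₀ 2
  ♯ = mkSym ♯₀ 0

  Σ : RankedAlphabet
  Σ = f ∷ ♯ ∷ Δ

  -- Encoding

  listTerm : ∀ {n} → Vec Term n → Term
  listTerm []       = node ♯ []
  listTerm (t ∷ ts) = node f (t ∷ listTerm ts ∷ [])

  numeral : ℕ → Term
  numeral n = listTerm (replicate n (node ♯ []))

  mutual
    encode : Term → Term
    encode (var x)     = var x
    encode (node s ts) =
      if does (s ∈? Δ) then node s (encodeV ts)
      else node f (numeral (name s) ∷ listTerm (encodeV ts) ∷ [])

    encodeV : ∀ {n} → Vec Term n → Vec Term n
    encodeV []       = []
    encodeV (t ∷ ts) = encode t ∷ encodeV ts

  mutual
    -- The coding leaves symbols of `Δ` in place, so an instance of a rule is coded as an instance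
    -- of the same rule.
    encode-subst : ∀ σ t → OverΓ Δ t → encode (subst σ t) ≡ subst (encode ∘ σ) t
    encode-subst σ (var x)     over = refl
    encode-subst σ (node s ts) over rewrite dec-true (s ∈? Δ) (over s (here refl)) =
      ≡.cong (node s) (encodeV-subst σ ts (λ s′ → over s′ ∘ there))

    encodeV-subst : ∀ σ {n} (ts : Vec Term n) → (∀ s → s ∈ symsV ts → s ∈ Δ) →
      encodeV (substV σ ts) ≡ substV (encode ∘ σ) ts
    encodeV-subst σ []       over = refl
    encodeV-subst σ (t ∷ ts) over =
      cong₂ _∷_ (encode-subst σ t (λ s → over s ∘ ∈-++⁺ˡ))
        (encodeV-subst σ ts (λ s → over s ∘ ∈-++⁺ʳ (syms t)))

  listTerm-cong : ∀ {n} {ts us : Vec Term n} →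
    Pointwise (R ⊢_⇒*_) ts us → R ⊢ listTerm ts ⇒* listTerm us
  listTerm-cong []       = ε
  listTerm-cong (p ∷ ps) = node-cong f (p ∷ listTerm-cong ps ∷ [])

  encodeV-update : ∀ {n} (ts : Vec Term n) i u → R ⊢ encode (Vec.lookup ts i) ⇒* encode u →
    Pointwise (R ⊢_⇒*_) (encodeV ts) (encodeV (ts [ i ]≔ u))
  encodeV-update (t ∷ ts) zero    u p = p ∷ steps-refl
  encodeV-update (t ∷ ts) (suc i) u p = ε ∷ encodeV-update ts i u p

  encode-step : ∀ {t u} → R ⊢ t ⇒ u → R ⊢ encode t ⇒* encode u
  encode-step (root ρ σ ρ∈R)
    rewrite encode-subst σ (lhs ρ) (lhs-over-sign ρ∈R)
          | encode-subst σ (rhs ρ) (rhs-over-sign ρ∈R) = return (root ρ (encode ∘ σ) ρ∈R)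
  encode-step (cong s ts i u d) with does (s ∈? Δ) | encodeV-update ts i u (encode-step d)
  ... | true  | ps = node-cong s ps
  ... | false | ps = node-cong f (ε ∷ listTerm-cong ps ∷ [])

  encode-⇒* : ∀ {t u} → R ⊢ t ⇒* u → R ⊢ encode t ⇒* encode u
  encode-⇒* = kleisliStar encode encode-step

  over-++ : ∀ {Γ xs} {ys : List Sym} → (∀ s → s ∈ xs → s ∈ Γ) → (∀ s → s ∈ ys → s ∈ Γ) →
    ∀ s → s ∈ xs ++ ys → s ∈ Γ
  over-++ {xs = xs} p q s s∈ with ∈-++⁻ xs s∈
  ... | inj₁ s∈xs = p s s∈xs
  ... | inj₂ s∈ys = q s s∈ys

  ground-f : ∀ t u → Ground Σ t → Ground Σ u → Ground Σ (node f (t ∷ u ∷ []))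
  ground-f t u (t-over , t-closed) (u-over , u-closed) =
    (λ { _ (here refl) → here refl
       ; s (there s∈)  → over-++ t-over (over-++ u-over (λ _ ())) s s∈ }) ,
    cong₂ _++_ t-closed (≡.cong (_++ []) u-closed)

  ground-♯ : Ground Σ (node ♯ [])
  ground-♯ = (λ { _ (here refl) → there (here refl) }) , refl

  GroundV : ∀ {n} → Vec Term n → Set
  GroundV ts = (∀ s → s ∈ symsV ts → s ∈ Σ) × varsV ts ≡ []

  ground-listTerm : ∀ {n} (ts : Vec Term n) → GroundV ts → Ground Σ (listTerm ts)
  ground-listTerm []       _               = ground-♯
  ground-listTerm (t ∷ ts) (over , closed) =
    ground-f t (listTerm ts) ((λ s → over s ∘ ∈-++⁺ˡ) , ++-conicalˡ (vars t) _ closed)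
      (ground-listTerm ts ((λ s → over s ∘ ∈-++⁺ʳ (syms t)) , ++-conicalʳ (vars t) _ closed))

  ground-numeral : ∀ n → Ground Σ (numeral n)
  ground-numeral ℕ.zero    = ground-♯
  ground-numeral (ℕ.suc n) = ground-f (node ♯ []) (numeral n) ground-♯ (ground-numeral n)

  mutual
    -- Every symbol outside `Δ` becomes a code over `f` and `♯`, so the single alphabet `Σ` serves
    -- the ground terms over every `Γ`.
    encode-ground : ∀ t → vars t ≡ [] → Ground Σ (encode t)
    encode-ground (node s ts) closed with s ∈? Δ | encodeV-ground ts closed
    ... | yes s∈Δ | over , closed′ =
      (λ { _ (here refl) → there (there s∈Δ) ; s′ (there s∈) → over s′ s∈ }) , closed′
    ... | no _    | ground =
      ground-f (numeral (name s)) (listTerm (encodeV ts)) (ground-numeral (name s)) (ground-listTerm _ ground)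

    encodeV-ground : ∀ {n} (ts : Vec Term n) → varsV ts ≡ [] → GroundV (encodeV ts)
    encodeV-ground []       _      = (λ _ ()) , refl
    encodeV-ground (t ∷ ts) closed =
      let over , closed₁ = encode-ground t (++-conicalˡ (vars t) _ closed)
          overV , closed₂ = encodeV-ground ts (++-conicalʳ (vars t) _ closed)
      in over-++ over overV , cong₂ _++_ closed₁ closed₂

  -- Decoding

  -- The continuation takes the length `k` as an argument because the rank of a decoded symbol is
  -- known only once its list has ended.
  data Mode : Set where
    asTerm : Mode
    asList : ((k : ℕ) → Vec Term k → Term) → Mode

  -- The continuation of asList receives the elements of the list read so far; symbols of Δ met
  -- on the way are emitted at once, which is what pulls them outwards. Every binary symbol
  -- outside Δ is read as f and every constant outside Δ as ♯; var 0 is a junk value.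
  mutual
    decode : Mode → Term → Term
    decode m (var x)     = var x
    decode m (node s ts) = if does (s ∈? Δ) then node s (decodeV m ts) else decodeArgs m ts

    decodeV : ∀ {n} → Mode → Vec Term n → Vec Term n
    decodeV m []       = []
    decodeV m (t ∷ ts) = decode m t ∷ decodeV m ts

    decodeArgs : ∀ {n} → Mode → Vec Term n → Term
    -- Only the length `n` of the first list is used, as the name. The second list is read inside
    -- the continuation of the first, so contexts found in `c` end up outside those found in `l`.
    decodeArgs asTerm     (c ∷ l ∷ []) =
      decode (asList λ n _ → decode (asList λ k ts → node (mkSym n k) ts) l) c
    decodeArgs (asList κ) []           = κ 0 []
    decodeArgs (asList κ) (t ∷ l ∷ []) =
      decode (asList λ k ts → κ (ℕ.suc k) (decode asTerm t ∷ ts)) l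
    decodeArgs asTerm     []                = var 0
    decodeArgs asTerm     (_ ∷ [])          = var 0
    decodeArgs asTerm     (_ ∷ _ ∷ _ ∷ _)   = var 0
    decodeArgs (asList κ) (_ ∷ [])          = var 0
    decodeArgs (asList κ) (_ ∷ _ ∷ _ ∷ _)   = var 0

  mutual
    -- Symbols of `Δ` are emitted and hand the mode on unchanged to all their arguments, so this
    -- holds in every mode.
    decode-subst : ∀ m σ t → OverΓ Δ t → decode m (subst σ t) ≡ subst (decode m ∘ σ) t
    decode-subst m σ (var x)     over = refl
    decode-subst m σ (node s ts) over rewrite dec-true (s ∈? Δ) (over s (here refl)) =
      ≡.cong (node s) (decodeV-subst m σ ts (λ s′ → over s′ ∘ there))

    decodeV-subst : ∀ m σ {n} (ts : Vec Term n) → (∀ s → s ∈ symsV ts → s ∈ Δ) →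
      decodeV m (substV σ ts) ≡ substV (decode m ∘ σ) ts
    decodeV-subst m σ []       over = refl
    decodeV-subst m σ (t ∷ ts) over =
      cong₂ _∷_ (decode-subst m σ t (λ s → over s ∘ ∈-++⁺ˡ))
        (decodeV-subst m σ ts (λ s → over s ∘ ∈-++⁺ʳ (syms t)))

  -- A logical relation: related continuations take rewritable arguments to rewritable results. Thus
  -- `m ≼ m` expresses that the continuation of `m` respects rewriting.
  data _≼_ : Mode → Mode → Set where
    asTerm : asTerm ≼ asTerm
    asList : ∀ {κ κ′} →
      (∀ {k} {ts us : Vec Term k} → Pointwise (R ⊢_⇒*_) ts us → R ⊢ κ k ts ⇒* κ′ k us) →
      asList κ ≼ asList κ′

  node-≼ : ∀ n → asList (λ k ts → node (mkSym n k) ts) ≼ asList (λ k ts → node (mkSym n k) ts)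
  node-≼ n = asList (node-cong (mkSym n _))

  mutual
    -- The continuation acts only where a list ends, below the symbols emitted before, and rewriting
    -- is closed under these.
    decode-mono : ∀ {m m′} → m ≼ m′ → ∀ t → R ⊢ decode m t ⇒* decode m′ t
    decode-mono p (var x)     = ε
    decode-mono p (node s ts) with does (s ∈? Δ)
    ... | true  = node-cong s (decodeV-mono p ts)
    ... | false = decodeArgs-mono p ts

    decodeV-mono : ∀ {m m′} → m ≼ m′ → ∀ {n} (ts : Vec Term n) →
      Pointwise (R ⊢_⇒*_) (decodeV m ts) (decodeV m′ ts)
    decodeV-mono p []       = []
    decodeV-mono p (t ∷ ts) = decode-mono p t ∷ decodeV-mono p ts

    decodeArgs-mono : ∀ {m m′} → m ≼ m′ → ∀ {n} (ts : Vec Term n) →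
      R ⊢ decodeArgs m ts ⇒* decodeArgs m′ ts
    decodeArgs-mono asTerm     ts                = ε
    decodeArgs-mono (asList p) []                = p []
    decodeArgs-mono (asList p) (t ∷ l ∷ [])      = decode-mono (asList (λ ps → p (ε ∷ ps))) l
    decodeArgs-mono (asList p) (_ ∷ [])          = ε
    decodeArgs-mono (asList p) (_ ∷ _ ∷ _ ∷ _)   = ε

  mutual
    -- A step in the part being read is handled by induction, a step in a part held by the
    -- continuation by `decode-mono`. One step may become several, as an emitted symbol copies the
    -- continuation into all its arguments.
    decode-step : ∀ {m} → m ≼ m → ∀ {t u} → R ⊢ t ⇒ u → R ⊢ decode m t ⇒* decode m u
    decode-step {m} p (root ρ σ ρ∈R)
      rewrite decode-subst m σ (lhs ρ) (lhs-over-sign ρ∈R)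
            | decode-subst m σ (rhs ρ) (rhs-over-sign ρ∈R) = return (root ρ (decode m ∘ σ) ρ∈R)
    decode-step p (cong s ts i u d) with does (s ∈? Δ)
    ... | true  = node-cong s (decodeV-step p ts i d)
    ... | false = decodeArgs-step p ts i d

    decodeV-step : ∀ {m} → m ≼ m → ∀ {n} (ts : Vec Term n) i {u} → R ⊢ Vec.lookup ts i ⇒ u →
      Pointwise (R ⊢_⇒*_) (decodeV m ts) (decodeV m (ts [ i ]≔ u))
    decodeV-step p (t ∷ ts) zero    d = decode-step p d ∷ steps-refl
    decodeV-step p (t ∷ ts) (suc i) d = ε ∷ decodeV-step p ts i d

    decodeArgs-step : ∀ {m} → m ≼ m → ∀ {n} (ts : Vec Term n) i {u} → R ⊢ Vec.lookup ts i ⇒ u →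
      R ⊢ decodeArgs m ts ⇒* decodeArgs m (ts [ i ]≔ u)
    decodeArgs-step asTerm     (c ∷ l ∷ []) zero       d =
      decode-step (asList λ {n} _ → decode-mono (node-≼ n) l) d
    decodeArgs-step asTerm     (c ∷ l ∷ []) (suc zero) d =
      decode-mono (asList λ {n} _ → decode-step (node-≼ n) d) c
    decodeArgs-step (asList p) (t ∷ l ∷ []) zero       d =
      decode-mono (asList λ ps → p (decode-step asTerm d ∷ ps)) l
    decodeArgs-step (asList p) (t ∷ l ∷ []) (suc zero) d =
      decode-step (asList λ ps → p (ε ∷ ps)) d
    -- With a wrong number of arguments both sides are the junk value; the split on the index only
    -- lets the update compute.
    decodeArgs-step asTerm     (_ ∷ [])        zero d = ε
    decodeArgs-step asTerm     (_ ∷ _ ∷ _ ∷ _) zero d = ε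
    decodeArgs-step asTerm     (_ ∷ _ ∷ _ ∷ _) (suc zero) d = ε
    decodeArgs-step asTerm     (_ ∷ _ ∷ _ ∷ _) (suc (suc zero)) d = ε
    decodeArgs-step asTerm     (_ ∷ _ ∷ _ ∷ _) (suc (suc (suc _))) d = ε
    decodeArgs-step (asList p) (_ ∷ [])        zero d = ε
    decodeArgs-step (asList p) (_ ∷ _ ∷ _ ∷ _) zero d = ε
    decodeArgs-step (asList p) (_ ∷ _ ∷ _ ∷ _) (suc zero) d = ε
    decodeArgs-step (asList p) (_ ∷ _ ∷ _ ∷ _) (suc (suc zero)) d = ε
    decodeArgs-step (asList p) (_ ∷ _ ∷ _ ∷ _) (suc (suc (suc _))) d = ε

  decode-⇒* : ∀ {t u} → R ⊢ t ⇒* u → R ⊢ decode asTerm t ⇒* decode asTerm u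
  decode-⇒* = kleisliStar (decode asTerm) (decode-step asTerm)

  -- As `f` and `♯` are fresh, nothing is emitted along the spine of an intact list.
  decode-listTerm : ∀ κ {n} (ts : Vec Term n) →
    decode (asList κ) (listTerm ts) ≡ κ n (decodeV asTerm ts)
  decode-listTerm κ []       rewrite dec-false (♯ ∈? Δ) ♯∉ = refl
  decode-listTerm κ (t ∷ ts) rewrite dec-false (f ∈? Δ) f∉ = decode-listTerm _ ts

  mutual
    decode-encode : ∀ t → decode asTerm (encode t) ≡ t
    decode-encode (var x)     = refl
    decode-encode (node s ts) with s ∈? Δ
    ... | yes s∈Δ rewrite dec-true (s ∈? Δ) s∈Δ = ≡.cong (node s) (decodeV-encodeV ts)
    ... | no _ rewrite dec-false (f ∈? Δ) f∉ =
      -- The length of the first list gives back the name, that of the second the rank.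
      ≡.trans (decode-listTerm _ (replicate (name s) (node ♯ [])))
        (≡.trans (decode-listTerm _ (encodeV ts)) (≡.cong (node s) (decodeV-encodeV ts)))

    decodeV-encodeV : ∀ {n} (ts : Vec Term n) → decodeV asTerm (encodeV ts) ≡ ts
    decodeV-encodeV []       = refl
    decodeV-encodeV (t ∷ ts) = cong₂ _∷_ (decode-encode t) (decodeV-encodeV ts)

  encode-reflects-⇒* : ∀ {t u} → R ⊢ encode t ⇒* encode u → R ⊢ t ⇒* u
  encode-reflects-⇒* {t} {u} d =
    ≡.subst₂ (R ⊢_⇒*_) (decode-encode t) (decode-encode u) (decode-⇒* d)

  -- Inverse images of recognizable languages under the encoding

  module Inverse (A : TreeAutomaton) where

    State : Set
    State = Fin (nStates A)

    -- This is the behaviour of `A` on `listTerm`, with the elements known only through their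
    -- states.
    ListRun : ∀ {n} → Vec State n → State → Set
    ListRun []       q = δ A ♯ [] q ≡ true
    ListRun (p ∷ ps) q = ∃ λ r → ListRun ps r × δ A f (p ∷ r ∷ []) q ≡ true

    listRun? : ∀ {n} (ps : Vec State n) q → Dec (ListRun ps q)
    listRun? []       q = δ A ♯ [] q Bool.≟ true
    listRun? (p ∷ ps) q = any? λ r → listRun? ps r ×-dec (δ A f (p ∷ r ∷ []) q Bool.≟ true)

    listRun⁺ : ∀ {n} {ts : Vec Term n} {ps q} → RunV A ts ps → ListRun ps q → Run A (listTerm ts) q
    listRun⁺ []       e           = run _ _ _ _ [] e
    listRun⁺ (r ∷ rs) (_ , l , e) = run _ _ _ _ (r ∷ listRun⁺ rs l ∷ []) e

    listRun⁻ : ∀ {n} (ts : Vec Term n) {q} →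
      Run A (listTerm ts) q → ∃ λ ps → RunV A ts ps × ListRun ps q
    listRun⁻ []       (run _ _ [] _ [] e) = [] , [] , e
    listRun⁻ (t ∷ ts) (run _ _ _ _ (r ∷ l ∷ []) e) =
      let ps , rs , l′ = listRun⁻ ts l in _ , r ∷ rs , _ , l′ , e

    CodeRun : ℕ → ∀ {n} → Vec State n → State → Set
    CodeRun k ps q = ∃ λ c → Run A (numeral k) c × ∃ λ l → ListRun ps l × δ A f (c ∷ l ∷ []) q ≡ true

    codeRun? : ∀ k {n} (ps : Vec State n) q → Dec (CodeRun k ps q)
    codeRun? k ps q =
      any? λ c → run? A (numeral k) c ×-dec
      any? λ l → listRun? ps l ×-dec (δ A f (c ∷ l ∷ []) q Bool.≟ true)

    -- One transition at a symbol outside `Δ` simulates `A` on its whole code. Since transitions are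
    -- Boolean, runs on numerals have to be decidable.
    inverse : TreeAutomaton
    inverse .nStates   = nStates A
    inverse .δ s ps q  = if does (s ∈? Δ) then δ A s ps q else does (codeRun? (name s) ps q)
    inverse .final     = final A

    mutual
      inverse⁻ : ∀ {t q} → Run inverse t q → Run A (encode t) q
      inverse⁻ (run s ts ps q rs e) with s ∈? Δ | codeRun? (name s) ps q | e
      ... | yes _ | _                       | e′ = run s _ ps q (inverseV⁻ rs) e′
      ... | no _  | yes (c , r , l , l′ , d) | _ =
        run f _ (c ∷ l ∷ []) q (r ∷ listRun⁺ (inverseV⁻ rs) l′ ∷ []) d
      ... | no _  | no _                    | ()

      inverseV⁻ : ∀ {n} {ts : Vec Term n} {ps} → RunV inverse ts ps → RunV A (encodeV ts) ps
      inverseV⁻ []       = []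
      inverseV⁻ (r ∷ rs) = inverse⁻ r ∷ inverseV⁻ rs

    inverse-δ : ∀ {s ps q} → s ∈ Δ → δ A s ps q ≡ true → δ inverse s ps q ≡ true
    inverse-δ {s} s∈Δ e rewrite dec-true (s ∈? Δ) s∈Δ = e

    inverse-δ-code : ∀ {s ps q} → s ∉ Δ → CodeRun (name s) ps q → δ inverse s ps q ≡ true
    inverse-δ-code {s} {ps} {q} s∉Δ r rewrite dec-false (s ∈? Δ) s∉Δ =
      dec-true (codeRun? (name s) ps q) r

    mutual
      inverse⁺ : ∀ t {q} → Run A (encode t) q → Run inverse t q
      inverse⁺ (node s ts) r with s ∈? Δ
      inverse⁺ (node s ts) (run _ _ ps q rs e) | yes s∈Δ =
        run s ts ps q (inverseV⁺ ts rs) (inverse-δ s∈Δ e)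
      inverse⁺ (node s ts) (run _ _ _ q (r ∷ l ∷ []) e) | no s∉Δ =
        let ps , rs , l′ = listRun⁻ (encodeV ts) l
        in run s ts ps q (inverseV⁺ ts rs) (inverse-δ-code s∉Δ (_ , r , _ , l′ , e))

      inverseV⁺ : ∀ {n} (ts : Vec Term n) {ps} → RunV A (encodeV ts) ps → RunV inverse ts ps
      inverseV⁺ []       []       = []
      inverseV⁺ (t ∷ ts) (r ∷ rs) = inverse⁺ t r ∷ inverseV⁺ ts rs

  -- Transfer of recognizability from `Σ` to all alphabets

  PΣRF⇒PΓRF : PΓRF R Σ → ∀ Γ → PΓRF R Γ
  PΣRF⇒PΓRF pf Γ L L-ground = inverse , λ t → to t , from t
    where
    encoded-ground : All (Ground Σ) (map encode L)
    encoded-ground = tabulate λ w∈ → let t , t∈L , eq = ∈-map⁻ encode w∈ in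
      ≡.subst (Ground Σ) (≡.sym eq) (encode-ground t (proj₂ (lookup L-ground t∈L)))

    A : TreeAutomaton
    A = proj₁ (pf (map encode L) encoded-ground)

    correct : ∀ w → (Descendants R Σ (FinLang (map encode L)) w → Lang Σ A w) ×
                    (Lang Σ A w → Descendants R Σ (FinLang (map encode L)) w)
    correct = proj₂ (pf (map encode L) encoded-ground)

    open Inverse A

    to : ∀ t → Descendants R Γ (FinLang L) t → Lang Γ inverse t
    to t (ground , u , u∈L , d) =
      let _ , q , r , e = proj₁ (correct (encode t))
            (encode-ground t (proj₂ ground) , encode u , ∈-map⁺ encode u∈L , encode-⇒* d)
      in ground , q , inverse⁺ t r , e

    from : ∀ t → Lang Γ inverse t → Descendants R Γ (FinLang L) t
    from t (ground , q , r , e)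
      with proj₂ (correct (encode t)) (encode-ground t (proj₂ ground) , q , inverse⁻ r , e)
    ... | _ , w , w∈ , d with ∈-map⁻ encode w∈
    -- The derivation starts from a code as well, so decoding recovers both of its ends.
    ... | u , u∈L , refl = ground , u , u∈L , encode-reflects-⇒* d

mainTheorem16 : (R : TRS) (f ♯ : Sym) → rank f ≡ 2 → rank ♯ ≡ 0 →
    f ∉ sign R → ♯ ∉ sign R →
    PΓRF R (f ∷ ♯ ∷ sign R) ⇔ PRF R
mainTheorem16 R (mkSym f₀ _) (mkSym ♯₀ _) refl refl f∉ ♯∉ =
  mk⇔ (λ pf Γ _ → Coding.PΣRF⇒PΓRF R f₀ ♯₀ f∉ ♯∉ pf Γ) (λ prf → prf _ (λ _ → there ∘ there))
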